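{- Every connected graph $G$ admits a strict majority dynamic monopoly of size at most $\alpha'(G)+1$. More generally, if $G$ has $c$ connected components, then $G$ admits a strict majority dynamic monopoly of size at most $\alpha'(G)+c$.
   Context: Graphs are finite, undirected, simple. $\alpha'(G)$ denotes the matching number (maximum number of pairwise disjoint edges). The strict majority threshold is $\tau(v)=\lceil(\deg(v)+1)/2\rceil$. For $M\subseteq V(G)$, the dynamic process starting from $M$ is $D_0=M$ and, for $i\ge0$, $D_{i+1}$ = set of vertices $v\notin D_0\cup\dots\cup D_i$ with at least $\tau(v)$ neighbours in $D_0\cup\dots\cup D_i$; $M$ is a strict majority dynamic monopoly if $\bigcup_i D_i=V(G)$. -}

module Defs where

open import Data.Nat using (ℕ; zero; suc; _+_; _≤_; _≥_; ⌈_/2⌉; _≤ᵇ_)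
open import Data.Bool using (Bool; true; false; if_then_else_; _∧_; _∨_)
open import Data.Fin using (Fin)
open import Data.Fin.Subset using (Subset; ∣_∣; ⊤)
open import Data.Vec using (lookup; tabulate)
open import Data.List using (List; allFin; map; length)
open import Data.Nat.ListAction using (sum)
open import Data.List.Relation.Unary.All using (All)
open import Data.List.Relation.Unary.AllPairs using (AllPairs)
open import Data.Product using (Σ; _×_; _,_; ∃)
open import Relation.Binary.PropositionalEquality using (_≡_; _≢_)
open import Relation.Nullary using (¬_)

record Graph (n : ℕ) : Set where
  field
    adj   : Fin n → Fin n → Bool
    sym   : ∀ u v → adj u v ≡ adj v u
    irrefl : ∀ v → adj v v ≡ false
open Graph public

countB : ∀ {n} → (Fin n → Bool) → ℕ
countB {n} p = sum (map (λ u → if p u then 1 else 0) (allFin n))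

deg : ∀ {n} → Graph n → Fin n → ℕ
deg G v = countB (adj G v)

τ : ∀ {n} → Graph n → Fin n → ℕ
τ G v = ⌈ suc (deg G v) /2⌉

nbrsIn : ∀ {n} → Graph n → Subset n → Fin n → ℕ
nbrsIn G S v = countB (λ u → adj G v u ∧ lookup S u)

majorityB : ∀ {n} → Graph n → Subset n → Fin n → Bool
majorityB G S v = τ G v ≤ᵇ nbrsIn G S v

-- A i = D_0 ∪ … ∪ D_i of the strict majority dynamic process from M
active : ∀ {n} → Graph n → Subset n → ℕ → Subset n
active G M zero    = M
active G M (suc i) = tabulate (λ v → lookup (active G M i) v ∨ majorityB G (active G M i) v)

IsDynamo : ∀ {n} → Graph n → Subset n → Set
IsDynamo G M = ∃ λ i → active G M i ≡ ⊤

Edge : ℕ → Set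
Edge n = Fin n × Fin n

IsEdge : ∀ {n} → Graph n → Edge n → Set
IsEdge G (u , v) = adj G u v ≡ true

Disjoint : ∀ {n} → Edge n → Edge n → Set
Disjoint (a , b) (c , d) = (a ≢ c) × (a ≢ d) × (b ≢ c) × (b ≢ d)

IsMatching : ∀ {n} → Graph n → List (Edge n) → Set
IsMatching G es = All (IsEdge G) es × AllPairs Disjoint es

IsMatchingNumber : ∀ {n} → Graph n → ℕ → Set
IsMatchingNumber G m =
  (Σ (List (Edge _)) λ es → IsMatching G es × length es ≡ m)
  × (∀ es → IsMatching G es → length es ≤ m)

data Reachable {n} (G : Graph n) : Fin n → Fin n → Set where
  here : ∀ {v} → Reachable G v v
  step : ∀ {u w v} → adj G u w ≡ true → Reachable G w v → Reachable G u v

IsComponentCount : ∀ {n} → Graph n → ℕ → Set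
IsComponentCount {n} G c =
  Σ (Fin n → Fin c) λ f →
    (∀ k → ∃ λ v → f v ≡ k)
    × (∀ u v → (f u ≡ f v → Reachable G u v) × (Reachable G u v → f u ≡ f v))

{-# OPTIONS --safe #-}
module Submission where

-- Activate one representative per component; let A be the set of active vertices and ν the
-- matching number of G - A.  It suffices to activate everything with ν more seeds whenever A
-- meets every component.  If some vertex t lies in every maximum matching of G - A, seed t and
-- recurse: ν drops by one.  Otherwise, by Gallai's lemma, a maximum matching of G - A misses at
-- most one vertex of each component H of G - A, so it has at least ⌊|H|/2⌋ edges inside H, and
-- it remains to activate H with ⌊|H|/2⌋ seeds.
--
-- In a linear order of H, the vertices whose neighbours in A or to the left are not a strict
-- majority form a suitable seed set.  A vertex is a seed for both an order and its reverse only
-- if it has no neighbour in A and as many neighbours on the left as on the right.  This can be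
-- avoided for all vertices at once: peel the leaves of a spanning tree of H whose root has a
-- neighbour in A, putting each leaf before or after all remaining vertices.  It has a remaining
-- neighbour, so one of the two choices is unbalanced.  Hence the order or its reverse has at
-- most ⌊|H|/2⌋ seeds.

open import Defs
open import Data.Nat using (ℕ; _+_; _≤_)
open import Data.Fin.Subset using (Subset; ∣_∣)
open import Data.Product using (Σ; _×_)

open import Data.Bool using (Bool; true; false; if_then_else_; _∧_; _∨_)
open import Data.Bool.Properties using () renaming (_≟_ to _≟ᵇ_)
open import Data.Empty using (⊥-elim)
open import Data.Fin using (Fin; zero; suc)
open import Data.Fin.Properties using (_≟_; any?; injective⇒≤)
open import Data.Fin.Subset using (⊤; ⊥)
open import Data.Fin.Subset.Properties using (∣⊥∣≡0)
open import Data.List using (List; []; _∷_; _++_; length; map; filter; foldr; allFin; lookup; tabulate)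
open import Data.List.Membership.DecPropositional using () renaming (_∈?_ to ∈?-for)
open import Data.List.Membership.Propositional using (_∈_; _∉_; find)
open import Data.List.Membership.Propositional.Properties using (∈-++⁺ˡ; ∈-++⁺ʳ; ∈-++⁻; ∈-allFin; ∈-filter⁺; ∈-lookup; ∈-tabulate⁺)
import Data.List.Membership.Setoid.Properties as Membershipₛ
open import Data.List.Properties using (length-++; length-tabulate; length-filter)
open import Data.List.Relation.Binary.Subset.Propositional using (_⊆_)
open import Data.List.Relation.Unary.All as All using (All; []; _∷_)
import Data.List.Relation.Unary.All.Properties as All
open import Data.List.Relation.Unary.AllPairs using ([]; _∷_)
open import Data.List.Relation.Unary.Any as Any using (here; there)
open import Data.List.Relation.Unary.Unique.Propositional using (Unique)
open import Data.List.Relation.Unary.Unique.Propositional.Properties using (tabulate⁺)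
open import Data.Nat using (zero; suc; _<_; _≤ᵇ_; _∸_; _⊔_; ⌊_/2⌋; z≤n; s≤s; _≤?_)
open import Data.Nat.ListAction using (sum)
open import Data.Nat.Properties hiding (_≟_)
open import Data.Product using (∃; ∃₂; _,_; proj₁; proj₂)
open import Data.Sum using (_⊎_; inj₁; inj₂; [_,_]′)
open import Data.Vec as Vec using (_[_]≔_)
import Data.Vec.Properties as Vec
open import Function using (_∘_; id)
open import Relation.Binary.PropositionalEquality as ≡ using (_≡_; _≢_; refl; cong; subst; trans)
open import Relation.Nullary using (¬_; Dec; yes; no; does; contradiction; ¬?)
open import Relation.Nullary.Decidable using (_×-dec_; map′; decidable-stable)

-- Sums over lists and duplicate-free lists.

module _ {A : Set} where

  sum-map-mono-≤ : ∀ {f g : A → ℕ} → (∀ x → f x ≤ g x) → ∀ xs → sum (map f xs) ≤ sum (map g xs)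
  sum-map-mono-≤ f≤g []       = z≤n
  sum-map-mono-≤ f≤g (x ∷ xs) = +-mono-≤ (f≤g x) (sum-map-mono-≤ f≤g xs)

  sum-map-mono-< : ∀ {f g : A → ℕ} → (∀ x → f x ≤ g x) →
    ∀ {y xs} → y ∈ xs → f y < g y → sum (map f xs) < sum (map g xs)
  sum-map-mono-< f≤g {xs = _ ∷ xs} (here refl) fy<gy = +-mono-<-≤ fy<gy (sum-map-mono-≤ f≤g xs)
  sum-map-mono-< f≤g {xs = x ∷ _}  (there y∈)  fy<gy = +-mono-≤-< (f≤g x) (sum-map-mono-< f≤g y∈ fy<gy)

  sum-map-+ : ∀ (f g : A → ℕ) xs →
    sum (map (λ x → f x + g x) xs) ≡ sum (map f xs) + sum (map g xs)
  sum-map-+ f g []       = refl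
  sum-map-+ f g (x ∷ xs) = begin
    f x + g x + sum (map (λ x → f x + g x) xs)         ≡⟨ cong (f x + g x +_) (sum-map-+ f g xs) ⟩
    f x + g x + (sum (map f xs) + sum (map g xs))      ≡⟨ +-assoc (f x) (g x) _ ⟩
    f x + (g x + (sum (map f xs) + sum (map g xs)))    ≡⟨ cong (f x +_) (+-comm (g x) _) ⟩
    f x + (sum (map f xs) + sum (map g xs) + g x)      ≡⟨ cong (f x +_) (+-assoc (sum (map f xs)) _ _) ⟩
    f x + (sum (map f xs) + (sum (map g xs) + g x))    ≡⟨ ≡.sym (+-assoc (f x) _ _) ⟩
    f x + sum (map f xs) + (sum (map g xs) + g x)      ≡⟨ cong (f x + sum (map f xs) +_) (+-comm _ (g x)) ⟩
    f x + sum (map f xs) + (g x + sum (map g xs))      ∎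
    where open ≡.≡-Reasoning

module _ {A : Set} where

  lookup-injective : ∀ {xs : List A} → Unique xs → ∀ {i j} → lookup xs i ≡ lookup xs j → i ≡ j
  lookup-injective (x≢ ∷ u) {zero}  {zero}  eq = refl
  lookup-injective (x≢ ∷ u) {zero}  {suc j} eq = contradiction eq (All.lookup x≢ (∈-lookup j))
  lookup-injective (x≢ ∷ u) {suc i} {zero}  eq = contradiction (≡.sym eq) (All.lookup x≢ (∈-lookup i))
  lookup-injective (x≢ ∷ u) {suc i} {suc j} eq = cong suc (lookup-injective u eq)

  Unique-⊆⇒length≤ : ∀ {xs ys : List A} → Unique xs → xs ⊆ ys → length xs ≤ length ys
  Unique-⊆⇒length≤ u xs⊆ys = injective⇒≤ {f = λ i → Any.index (xs⊆ys (∈-lookup i))}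
    (λ {i} {j} eq → lookup-injective u
      (Membershipₛ.index-injective (≡.setoid A) (xs⊆ys (∈-lookup i)) (xs⊆ys (∈-lookup j)) eq))

  Unique-++⁻ˡ : ∀ (xs : List A) {ys} → Unique (xs ++ ys) → Unique xs
  Unique-++⁻ˡ []       _        = []
  Unique-++⁻ˡ (x ∷ xs) (x≢ ∷ u) = All.++⁻ˡ xs x≢ ∷ Unique-++⁻ˡ xs u

Unique⇒length≤n : ∀ {n} {xs : List (Fin n)} → Unique xs → length xs ≤ n
Unique⇒length≤n {n} {xs} u =
  subst (length xs ≤_) (length-tabulate id) (Unique-⊆⇒length≤ u (λ {x} _ → ∈-allFin x))

-- Seed sets listed by their vertices.

fromList : ∀ {n} → List (Fin n) → Subset n
fromList = foldr (λ x p → p [ x ]≔ true) ⊥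

∣p[x]≔true∣≤1+∣p∣ : ∀ {n} (p : Subset n) x → ∣ p [ x ]≔ true ∣ ≤ suc ∣ p ∣
∣p[x]≔true∣≤1+∣p∣ (true  Vec.∷ p) zero    = n≤1+n _
∣p[x]≔true∣≤1+∣p∣ (false Vec.∷ p) zero    = ≤-refl
∣p[x]≔true∣≤1+∣p∣ (true  Vec.∷ p) (suc x) = s≤s (∣p[x]≔true∣≤1+∣p∣ p x)
∣p[x]≔true∣≤1+∣p∣ (false Vec.∷ p) (suc x) = ∣p[x]≔true∣≤1+∣p∣ p x

∣fromList∣≤length : ∀ {n} (xs : List (Fin n)) → ∣ fromList xs ∣ ≤ length xs
∣fromList∣≤length {n} []  = ≤-reflexive (∣⊥∣≡0 n)
∣fromList∣≤length (x ∷ xs) = ≤-trans (∣p[x]≔true∣≤1+∣p∣ (fromList xs) x) (s≤s (∣fromList∣≤length xs))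

∈⇒lookup-fromList : ∀ {n} {xs : List (Fin n)} {x} → x ∈ xs → Vec.lookup (fromList xs) x ≡ true
∈⇒lookup-fromList {xs = _ ∷ xs} {x} (here refl) = Vec.lookup∘update x (fromList xs) true
∈⇒lookup-fromList {xs = y ∷ xs} {x} (there x∈) with x ≟ y
... | yes refl = Vec.lookup∘update x (fromList xs) true
... | no x≢y   = trans (Vec.lookup∘update′ x≢y (fromList xs) true) (∈⇒lookup-fromList x∈)

∨-true⁺ˡ : ∀ {a b} → a ≡ true → a ∨ b ≡ true
∨-true⁺ˡ refl = refl

module _ {n : ℕ} (G : Graph n) where

  _∈?_ : (u : Fin n) (S : List (Fin n)) → Dec (u ∈ S)
  _∈?_ = ∈?-for _≟_

  _∼_ : Fin n → Fin n → Set
  u ∼ v = adj G u v ≡ true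

  ∼-sym : ∀ {u v} → u ∼ v → v ∼ u
  ∼-sym {u} {v} u∼v = trans (sym G v u) u∼v

  ∼⇒≢ : ∀ {u v} → u ∼ v → u ≢ v
  ∼⇒≢ {u} u∼u refl with () ← trans (≡.sym u∼u) (irrefl G u)

  -- Counting neighbours

  nbrs : Fin n → List (Fin n) → ℕ
  nbrs v S = countB (λ u → adj G v u ∧ does (u ∈? S))

  private
    χ : Bool → ℕ
    χ b = if b then 1 else 0

    χ-nbr : Fin n → List (Fin n) → Fin n → ℕ
    χ-nbr v S u = χ (adj G v u ∧ does (u ∈? S))

    χ-cover : ∀ {v S T} → (∀ {u} → v ∼ u → u ∈ S ⊎ u ∈ T) →
      ∀ u → χ (adj G v u) ≤ χ-nbr v S u + χ-nbr v T u
    χ-cover {v} {S} {T} cover u with adj G v u in v∼u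
    ... | false = z≤n
    ... | true with u ∈? S | u ∈? T
    ...   | yes _ | _     = s≤s z≤n
    ...   | no _  | yes _ = s≤s z≤n
    ...   | no ∉S | no ∉T = contradiction (cover v∼u) [ ∉S , ∉T ]′

    χ-mono : ∀ {v S T} → S ⊆ T → ∀ u → χ-nbr v S u ≤ χ-nbr v T u
    χ-mono {v} {S} {T} S⊆T u with adj G v u
    ... | false = z≤n
    ... | true with u ∈? S | u ∈? T
    ...   | no _   | _     = z≤n
    ...   | yes _  | yes _ = s≤s z≤n
    ...   | yes ∈S | no ∉T = contradiction (S⊆T ∈S) ∉T

    χ-nbr-∈ : ∀ {v S x} → v ∼ x → x ∈ S → χ-nbr v S x ≡ 1
    χ-nbr-∈ {v} {S} {x} v∼x x∈S rewrite v∼x with x ∈? S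
    ... | yes _  = refl
    ... | no x∉S = contradiction x∈S x∉S

    χ-nbr-∉ : ∀ {v S x} → v ∼ x → x ∉ S → χ-nbr v S x ≡ 0
    χ-nbr-∉ {v} {S} {x} v∼x x∉S rewrite v∼x with x ∈? S
    ... | yes x∈S = contradiction x∈S x∉S
    ... | no _    = refl

  deg≤nbrs+nbrs : ∀ {v S T} → (∀ {u} → v ∼ u → u ∈ S ⊎ u ∈ T) → deg G v ≤ nbrs v S + nbrs v T
  deg≤nbrs+nbrs {v} {S} {T} cover = ≤-trans (sum-map-mono-≤ (χ-cover cover) (allFin n))
    (≤-reflexive (sum-map-+ (χ-nbr v S) (χ-nbr v T) (allFin n)))

  -- The neighbour `x` is counted twice on the right. It will be a neighbour in `A`, which is active
  -- in both orders.
  deg<nbrs+nbrs : ∀ {v S T} → (∀ {u} → v ∼ u → u ∈ S ⊎ u ∈ T) →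
    ∀ {x} → v ∼ x → x ∈ S → x ∈ T → deg G v < nbrs v S + nbrs v T
  deg<nbrs+nbrs {v} {S} {T} cover {x} v∼x x∈S x∈T =
    <-≤-trans (sum-map-mono-< (χ-cover cover) (∈-allFin x) 1<2)
      (≤-reflexive (sum-map-+ (χ-nbr v S) (χ-nbr v T) (allFin n)))
    where
    1<2 : χ (adj G v x) < χ-nbr v S x + χ-nbr v T x
    1<2 rewrite χ-nbr-∈ {S = S} v∼x x∈S | χ-nbr-∈ {S = T} v∼x x∈T | v∼x = ≤-refl

  nbrs-mono-< : ∀ {v S T} → S ⊆ T → ∀ {x} → v ∼ x → x ∉ S → x ∈ T → nbrs v S < nbrs v T
  nbrs-mono-< {v} {S} {T} S⊆T {x} v∼x x∉S x∈T = sum-map-mono-< (χ-mono S⊆T) (∈-allFin x) 0<1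
    where
    0<1 : χ-nbr v S x < χ-nbr v T x
    0<1 rewrite χ-nbr-∉ {S = S} v∼x x∉S | χ-nbr-∈ {S = T} v∼x x∈T = ≤-refl

  -- The dynamic process

  Activated : Subset n → Fin n → Set
  Activated M v = ∃ λ i → Vec.lookup (active G M i) v ≡ true

  active-suc : ∀ M i {v} → Vec.lookup (active G M i) v ≡ true → Vec.lookup (active G M (suc i)) v ≡ true
  active-suc M i {v} v∈ = trans (Vec.lookup∘tabulate _ v) (∨-true⁺ˡ v∈)

  active-+ : ∀ M i j {v} → Vec.lookup (active G M i) v ≡ true → Vec.lookup (active G M (j + i)) v ≡ true
  active-+ M i zero    v∈ = v∈
  active-+ M i (suc j) v∈ = active-suc M (j + i) (active-+ M i j v∈)

  active-mono : ∀ M {i j v} → i ≤ j → Vec.lookup (active G M i) v ≡ true → Vec.lookup (active G M j) v ≡ true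
  active-mono M {i} {j} {v} i≤j v∈ =
    subst (λ l → Vec.lookup (active G M l) v ≡ true) (m∸n+n≡m i≤j) (active-+ M i (j ∸ i) v∈)

  -- Active sets only grow, so the latest of finitely many activation times serves all of `S`.
  common-time : ∀ {M} S → (∀ {u} → u ∈ S → Activated M u) →
    ∃ λ i → ∀ {u} → u ∈ S → Vec.lookup (active G M i) u ≡ true
  common-time []      act = 0 , λ ()
  common-time {M} (x ∷ S) act with act (here refl) | common-time S (act ∘ there)
  ... | i , x∈ | j , S⊆ = i ⊔ j , λ where
    (here refl) → active-mono M (m≤m⊔n i j) x∈
    (there u∈)  → active-mono M (m≤n⊔m i j) (S⊆ u∈)

  majority⇒Activated : ∀ {M v} S → (∀ {u} → u ∈ S → Activated M u) → τ G v ≤ nbrs v S → Activated M v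
  majority⇒Activated {M} {v} S act τ≤ with common-time S act
  ... | i , S⊆ = suc i , trans (Vec.lookup∘tabulate _ v) lemma
    where
    pointwise : ∀ u → χ-nbr v S u ≤ χ (adj G v u ∧ Vec.lookup (active G M i) u)
    pointwise u with adj G v u
    ... | false = z≤n
    ... | true with u ∈? S
    ...   | no _ = z≤n
    ...   | yes u∈ rewrite S⊆ u∈ = ≤-refl

    majority : majorityB G (active G M i) v ≡ true
    majority with τ G v ≤ᵇ nbrsIn G (active G M i) v
                | ≤⇒≤ᵇ (≤-trans τ≤ (sum-map-mono-≤ pointwise (allFin n)))
    ... | true | _ = refl

    lemma : Vec.lookup (active G M i) v ∨ majorityB G (active G M i) v ≡ true
    lemma with Vec.lookup (active G M i) v
    ... | true  = refl
    ... | false = majority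

  Activated⇒IsDynamo : ∀ {M} → (∀ u → Activated M u) → IsDynamo G M
  Activated⇒IsDynamo {M} act with common-time (allFin n) (λ {u} _ → act u)
  ... | i , all = i , trans (≡.sym (Vec.tabulate∘lookup _)) (trans
    (Vec.tabulate-cong (λ u → trans (all (∈-allFin u)) (≡.sym (Vec.lookup-replicate u true))))
    (Vec.tabulate∘lookup ⊤))

  -- Ranging over every `M` that contains the seeds and at some time activates `S` makes spreads
  -- composable: what one activates can be the source of the next.
  Spreads : List (Fin n) → List (Fin n) → List (Fin n) → Set
  Spreads xs S T = ∀ {M} → (∀ {u} → u ∈ S → Activated M u) →
    (∀ {u} → u ∈ xs → Vec.lookup M u ≡ true) → ∀ {u} → u ∈ T → Activated M u

  -- Orderings of a connected set

  -- The vertices already peeled are F (put before hs) and B (put after hs); in the reverse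
  -- order the two are exchanged, whereas A is active from the start in both.
  record Split (A hs F B : List (Fin n)) : Set where
    constructor split
    field
      {front back}  : List (Fin n)
      length≤       : length front + length back ≤ length hs
      front-spreads : Spreads front (F ++ A) hs
      back-spreads  : Spreads back (B ++ A) hs

  swap-Split : ∀ {A hs F B} → Split A hs B F → Split A hs F B
  swap-Split (split {xs} {ys} l s t) = split (≤-trans (≤-reflexive (+-comm (length ys) (length xs))) l) t s

  -- When a vertex of `hs` is peeled to the front, its predecessors are `F ++ A` in the order, and
  -- in the reverse `B ++ A` with the other vertices of `hs`.
  Enclosed : (A hs F B : List (Fin n)) → Set
  Enclosed A hs F B = ∀ {x y} → x ∈ hs → x ∼ y → y ∈ F ++ A ⊎ y ∈ hs ++ (B ++ A)

  Fresh : (A hs F : List (Fin n)) → Set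
  Fresh A hs F = ∀ {x} → x ∈ hs → x ∉ F ++ A

  -- `F` and `B` are arbitrary so that the induction may put a leaf on either side.
  Peelable : (A hs : List (Fin n)) → Set
  Peelable A hs = ∀ F B → Fresh A hs F → Fresh A hs B → Enclosed A hs F B → Split A hs F B

  swap-Enclosed : ∀ {A hs F B} → Enclosed A hs F B → Enclosed A hs B F
  swap-Enclosed {hs = hs} enc x∈ x∼y with enc x∈ x∼y
  ... | inj₁ y∈ = inj₂ (∈-++⁺ʳ hs y∈)
  ... | inj₂ y∈ with ∈-++⁻ hs y∈
  ...   | inj₁ y∈hs = inj₂ (∈-++⁺ˡ y∈hs)
  ...   | inj₂ y∈BA = inj₁ y∈BA

  -- The number `suc ⌊ d /2⌋` is the threshold `τ` at degree `d`. If all three failed, `p`, `q` and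
  -- `q′` would be at most `⌊ d /2⌋`; then `p < q′` gives `p + q < d`, and `d < p + q` contradicts
  -- `p + q ≤ d`.
  majority-among-three : ∀ {d p q q′} → d ≤ p + q → (p < q′ ⊎ d < p + q) →
    (suc ⌊ d /2⌋ ≤ p ⊎ suc ⌊ d /2⌋ ≤ q) ⊎ suc ⌊ d /2⌋ ≤ q′
  majority-among-three {d} {p} {q} {q′} d≤ strict
    with suc ⌊ d /2⌋ ≤? p | suc ⌊ d /2⌋ ≤? q | suc ⌊ d /2⌋ ≤? q′
  ... | yes h | _     | _     = inj₁ (inj₁ h)
  ... | no _  | yes h | _     = inj₁ (inj₂ h)
  ... | no _  | no _  | yes h = inj₂ h
  ... | no ¬p | no ¬q | no ¬q′ = ⊥-elim (case strict)
    where
    p≤ = ≤-pred (≰⇒> ¬p)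
    q≤ = ≤-pred (≰⇒> ¬q)
    2⌊d/2⌋≤d : ⌊ d /2⌋ + ⌊ d /2⌋ ≤ d
    2⌊d/2⌋≤d = ≤-trans (+-monoʳ-≤ ⌊ d /2⌋ (⌊n/2⌋≤⌈n/2⌉ d)) (≤-reflexive (⌊n/2⌋+⌈n/2⌉≡n d))
    case : ¬ (p < q′ ⊎ d < p + q)
    case (inj₁ p<q′) = <-irrefl refl (<-≤-trans
      (≤-<-trans d≤ (+-mono-<-≤ (<-≤-trans p<q′ (≤-pred (≰⇒> ¬q′))) q≤)) 2⌊d/2⌋≤d)
    case (inj₂ d<)   = <-irrefl refl (<-≤-trans d< (≤-trans (+-mono-≤ p≤ q≤) 2⌊d/2⌋≤d))

  module _ {A : List (Fin n)} where

    -- Peeled to the front, `v` comes after `F ++ A` in the order and after `hs ++ (B ++ A)` in the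
    -- reverse. Where it has a majority it is activated by its predecessors, so it is a seed of the
    -- other order only.
    place-front : ∀ {v hs} → v ∉ hs → Peelable A hs → ∀ F B →
      Fresh A (v ∷ hs) F → Fresh A (v ∷ hs) B → Enclosed A (v ∷ hs) F B →
      τ G v ≤ nbrs v (F ++ A) ⊎ τ G v ≤ nbrs v (hs ++ (B ++ A)) →
      Split A (v ∷ hs) F B
    place-front {v} {hs} v∉hs peel F B freshF freshB enc good = result good
      where
      freshF′ : Fresh A hs (v ∷ F)
      freshF′ x∈ (here refl) = v∉hs x∈
      freshF′ x∈ (there x∈F) = freshF (there x∈) x∈F

      enc′ : Enclosed A hs (v ∷ F) B
      enc′ x∈ x∼y with enc (there x∈) x∼y
      ... | inj₁ y∈         = inj₁ (there y∈)
      ... | inj₂ (here y≡v) = inj₁ (here y≡v)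
      ... | inj₂ (there y∈) = inj₂ y∈

      sub : Split A hs (v ∷ F) B
      sub = peel (v ∷ F) B freshF′ (freshB ∘ there) enc′
      open Split sub

      front′ : ∀ {M} → (∀ {u} → u ∈ F ++ A → Activated M u) →
        (∀ {u} → u ∈ front → Vec.lookup M u ≡ true) → Activated M v → ∀ {u} → u ∈ v ∷ hs → Activated M u
      front′ act seed av (here refl) = av
      front′ act seed av (there u∈)  =
        front-spreads (λ { (here refl) → av ; (there x∈) → act x∈ }) seed u∈

      back′ : ∀ {M} → (∀ {u} → u ∈ B ++ A → Activated M u) →
        (∀ {u} → u ∈ back → Vec.lookup M u ≡ true) → Activated M v → ∀ {u} → u ∈ v ∷ hs → Activated M u
      back′ act seed av (here refl) = av
      back′ act seed av (there u∈)  = back-spreads act seed u∈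

      result : τ G v ≤ nbrs v (F ++ A) ⊎ τ G v ≤ nbrs v (hs ++ (B ++ A)) → Split A (v ∷ hs) F B
      result (inj₁ τ≤) = split {back = v ∷ back}
        (≤-trans (≤-reflexive (+-suc (length front) (length back))) (s≤s length≤))
        (λ act seed → front′ act seed (majority⇒Activated (F ++ A) act τ≤))
        (λ act seed → back′ act (seed ∘ there) (0 , seed (here refl)))
      result (inj₂ τ≤) = split {front = v ∷ front} (s≤s length≤)
        (λ act seed → front′ act (seed ∘ there) (0 , seed (here refl)))
        (λ act seed → back′ act seed (majority⇒Activated (hs ++ (B ++ A))
          ([ back-spreads act seed , act ]′ ∘ ∈-++⁻ hs) τ≤))

    -- In front, `v` sees `p` earlier neighbours in the order and `q` in the reverse; at the back it
    -- sees `q′` in the order. The neighbour `x` breaks the tie: in `hs` it makes `q′` exceed `p`,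
    -- and in `A` it is counted in both `p` and `q`.
    Peelable-∷ : ∀ {v hs x} → v ∉ hs → x ∈ hs ++ A → v ∼ x → Peelable A hs → Peelable A (v ∷ hs)
    Peelable-∷ {v} {hs} {x} v∉hs x∈ v∼x peel F B freshF freshB enc
      with majority-among-three {q′ = nbrs v (hs ++ (F ++ A))} (deg≤nbrs+nbrs cover) strict
      where
      cover : ∀ {u} → v ∼ u → u ∈ F ++ A ⊎ u ∈ hs ++ (B ++ A)
      cover v∼u with enc (here refl) v∼u
      ... | inj₁ u∈          = inj₁ u∈
      ... | inj₂ (here refl) = contradiction refl (∼⇒≢ v∼u)
      ... | inj₂ (there u∈)  = inj₂ u∈

      strict : nbrs v (F ++ A) < nbrs v (hs ++ (F ++ A)) ⊎
               deg G v < nbrs v (F ++ A) + nbrs v (hs ++ (B ++ A))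
      strict with ∈-++⁻ hs x∈
      ... | inj₁ x∈hs = inj₁ (nbrs-mono-< (∈-++⁺ʳ hs) v∼x (freshF (there x∈hs)) (∈-++⁺ˡ x∈hs))
      ... | inj₂ x∈A  = inj₂ (deg<nbrs+nbrs cover v∼x (∈-++⁺ʳ F x∈A) (∈-++⁺ʳ hs (∈-++⁺ʳ B x∈A)))
    ... | inj₁ good = place-front v∉hs peel F B freshF freshB enc good
    -- Putting `v` at the back is putting it in front with the two orders exchanged.
    ... | inj₂ good = swap-Split (place-front v∉hs peel B F freshB freshF (swap-Enclosed {F = F} {B} enc) (inj₂ good))

    -- The youngest vertex comes first, so the list is itself a leaf-peeling order. For the root,
    -- the edge into `A` stands in for the edge to a parent.
    data Tree : List (Fin n) → Set where
      root : ∀ {r a} → r ∉ A → a ∈ A → r ∼ a → Tree (r ∷ [])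
      grow : ∀ {y x hs} → y ∉ hs ++ A → x ∈ hs → y ∼ x → Tree hs → Tree (y ∷ hs)

    Tree-Unique : Unique A → ∀ {hs} → Tree hs → Unique (hs ++ A)
    Tree-Unique u (root r∉ _ _)   = All.¬Any⇒All¬ A r∉ ∷ u
    Tree-Unique u (grow y∉ _ _ t) = All.¬Any⇒All¬ _ y∉ ∷ Tree-Unique u t

    Tree-nonempty : ∀ {hs} → Tree hs → 0 < length hs
    Tree-nonempty (root _ _ _)   = s≤s z≤n
    Tree-nonempty (grow _ _ _ _) = s≤s z≤n

    Tree-fresh : ∀ {hs} → Tree hs → Fresh A hs []
    Tree-fresh (root r∉ _ _)            (here refl) = r∉
    Tree-fresh (grow {hs = hs} y∉ _ _ _) (here refl) = y∉ ∘ ∈-++⁺ʳ hs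
    Tree-fresh (grow _ _ _ t)           (there x∈)  = Tree-fresh t x∈

    Tree-Peelable : ∀ {hs} → Tree hs → Peelable A hs
    Tree-Peelable (root _ a∈ r∼a) =
      Peelable-∷ (λ ()) a∈ r∼a (λ _ _ _ _ _ → split {front = []} {[]} z≤n (λ _ _ ()) (λ _ _ ()))
    Tree-Peelable (grow y∉ x∈ y∼x t) =
      Peelable-∷ (y∉ ∘ ∈-++⁺ˡ) (∈-++⁺ˡ x∈) y∼x (Tree-Peelable t)

    Closed : List (Fin n) → Set
    Closed hs = ∀ {x y} → x ∈ hs → x ∼ y → y ∈ hs ++ A

    grow-to-Closed : Unique A → ∀ d {hs} → Tree hs → n ≤ length (hs ++ A) + d →
      ∃ λ hs′ → Tree hs′ × Closed hs′
    grow-to-Closed u d {hs} t n≤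
      with any? (λ y → ¬? (y ∈? (hs ++ A)) ×-dec any? (λ x → (x ∈? hs) ×-dec (adj G y x ≟ᵇ true)))
    ... | no ¬∃ = hs , t , λ {x} {y} x∈ x∼y → decidable-stable (y ∈? (hs ++ A))
                    (λ y∉ → ¬∃ (y , y∉ , x , x∈ , ∼-sym x∼y))
    grow-to-Closed u zero {hs} t n≤ | yes (y , y∉ , x , x∈ , y∼x) =
      contradiction (≤-trans n≤ (≤-reflexive (+-identityʳ _)))
        (<⇒≱ (Unique⇒length≤n (Tree-Unique u (grow y∉ x∈ y∼x t))))
    grow-to-Closed u (suc d) {hs} t n≤ | yes (y , y∉ , x , x∈ , y∼x) =
      grow-to-Closed u d (grow y∉ x∈ y∼x t) (≤-trans n≤ (≤-reflexive (+-suc _ d)))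

  -- Matchings

  Misses : List (Edge n) → Fin n → Set
  Misses es z = All (λ e → z ≢ proj₁ e × z ≢ proj₂ e) es

  misses? : ∀ es z → Dec (Misses es z)
  misses? es z = All.all? (λ e → ¬? (z ≟ proj₁ e) ×-dec ¬? (z ≟ proj₂ e)) es

  data Matching : List (Edge n) → Set where
    []   : Matching []
    cons : ∀ {u v es} → u ∼ v → Misses es u → Misses es v → Matching es → Matching ((u , v) ∷ es)

  Matching⇒IsMatching : ∀ {es} → Matching es → IsMatching G es
  Matching⇒IsMatching [] = [] , []
  Matching⇒IsMatching (cons u∼v mu mv m) with Matching⇒IsMatching m
  ... | edges , disjoint = u∼v ∷ edges ,
    All.zipWith (λ ((u≢a , u≢b) , v≢a , v≢b) → u≢a , u≢b , v≢a , v≢b) (mu , mv) ∷ disjoint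

  Avoids : (Fin n → Set) → List (Edge n) → Set
  Avoids X es = ∀ {z} → X z → Misses es z

  -- Reordering the edges and turning the one at `t` does not change which vertices are covered.
  -- With this, `exchange` takes off one edge of its alternating path at a time.
  extract : ∀ {es t} → Matching es → ¬ Misses es t →
    ∃₂ λ x es′ → Matching ((t , x) ∷ es′) × length es ≡ suc (length es′) ×
      (∀ {z} → Misses es z → Misses ((t , x) ∷ es′) z)
  extract [] ¬miss = contradiction [] ¬miss
  extract {(a , b) ∷ es} {t} (cons a∼b ma mb m) ¬miss with t ≟ a | t ≟ b
  ... | yes refl | _        = b , es , cons a∼b ma mb m , refl , id
  ... | no _     | yes refl = a , es , cons (∼-sym a∼b) mb ma m , refl ,
                                λ { ((z≢a , z≢b) ∷ mz) → (z≢b , z≢a) ∷ mz }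
  ... | no t≢a   | no t≢b with extract m (λ mt → ¬miss ((t≢a , t≢b) ∷ mt))
  ...   | x , es′ , cons t∼x mt mx m′ , len , f with f ma | f mb
  ...     | (a≢t , a≢x) ∷ ma′ | (b≢t , b≢x) ∷ mb′ =
    x , (a , b) ∷ es′ ,
    cons t∼x ((t≢a , t≢b) ∷ mt) (((≡.≢-sym a≢x) , (≡.≢-sym b≢x)) ∷ mx) (cons a∼b ma′ mb′ m′) ,
    cong suc len ,
    λ { (z≢ab ∷ mz) → case-f z≢ab (f mz) }
    where
    case-f : ∀ {z} → z ≢ a × z ≢ b → Misses ((t , x) ∷ es′) z → Misses ((t , x) ∷ (a , b) ∷ es′) z
    case-f z≢ab (z≢tx ∷ mz) = z≢tx ∷ z≢ab ∷ mz

  -- The alternating path of M and N starting at t ends in at most one of the vertices u, v.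
  exchange : ∀ k {X M N t u v} → Matching M → Matching N → length M ≡ k → length N ≡ k →
    Avoids X M → Avoids X N → Misses N t → Misses M u → Misses M v → u ≢ v →
    (∃ λ P → Matching P × Avoids X P × length P ≡ suc k) ⊎
    (∃ λ P → Matching P × Avoids X P × length P ≡ k × Misses P t × (Misses P u ⊎ Misses P v))
  exchange k {X} {M} {N} {t} {u} {v} mM mN lM lN aM aN Nt Mu Mv u≢v with misses? M t
  ... | yes Mt = inj₂ (M , mM , aM , lM , Mt , inj₁ Mu)
  ... | no ¬Mt with extract mM ¬Mt
  ...   | x , M′ , cons t∼x M′t M′x mM′ , l , f with misses? N x
  ...     | yes Nx = inj₁ ((t , x) ∷ N , cons t∼x Nt Nx mN , (λ z∈ → All.head (f (aM z∈)) ∷ aN z∈) , cong suc lN)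
  ...     | no ¬Nx with extract mN ¬Nx
  exchange zero    {M = []} _ _ _ _ _ _ _ _ _ _ | no ¬Mt | x , _ | no _ | _ = contradiction [] ¬Mt
  exchange (suc k) {X} {M} {N} {t} {u} {v} mM mN lM lN aM aN Nt Mu Mv u≢v
    | no ¬Mt | x , M′ , cons t∼x M′t M′x mM′ , l , f | no ¬Nx
    | y , N′ , cons x∼y N′x N′y mN′ , l′ , f′ with misses? M′ y
  ... | yes M′y = inj₂ ((x , y) ∷ M′ , cons x∼y M′x M′y mM′ ,
                    (λ z∈ → All.head (f′ (aN z∈)) ∷ All.tail (f (aM z∈))) ,
                    trans (≡.sym l) lM , All.head (f′ Nt) ∷ M′t , one)
    where
    one : Misses ((x , y) ∷ M′) u ⊎ Misses ((x , y) ∷ M′) v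
    one with u ≟ y
    ... | no u≢y   = inj₁ ((proj₂ (All.head (f Mu)) , u≢y) ∷ All.tail (f Mu))
    ... | yes refl = inj₂ ((proj₂ (All.head (f Mv)) , ≡.≢-sym u≢v) ∷ All.tail (f Mv))
  -- The path goes on from `y` in `M′` and `N′`. Adding `t` and `x` to the avoided set allows `t x`
  -- or `x y` to be put back afterwards.
  ... | no ¬M′y
    with exchange k {λ z → X z ⊎ z ≡ t ⊎ z ≡ x} {t = y} mM′ mN′
           (suc-injective (trans (≡.sym l) lM)) (suc-injective (trans (≡.sym l′) lN))
           (λ { (inj₁ z∈) → All.tail (f (aM z∈)) ; (inj₂ (inj₁ refl)) → M′t ; (inj₂ (inj₂ refl)) → M′x })
           (λ { (inj₁ z∈) → All.tail (f′ (aN z∈)) ; (inj₂ (inj₁ refl)) → All.tail (f′ Nt) ; (inj₂ (inj₂ refl)) → N′x })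
           N′y (All.tail (f Mu)) (All.tail (f Mv)) u≢v
  ...   | inj₁ (P , mP , aP , lP) = inj₁ ((t , x) ∷ P ,
            cons t∼x (aP (inj₂ (inj₁ refl))) (aP (inj₂ (inj₂ refl))) mP ,
            (λ z∈ → All.head (f (aM z∈)) ∷ aP (inj₁ z∈)) , cong suc lP)
  ...   | inj₂ (P , mP , aP , lP , Py , Puv) = inj₂ ((x , y) ∷ P ,
            cons x∼y (aP (inj₂ (inj₂ refl))) Py mP ,
            (λ z∈ → All.head (f′ (aN z∈)) ∷ aP (inj₁ z∈)) , cong suc lP ,
            All.head (f′ Nt) ∷ aP (inj₂ (inj₁ refl)) ,
            [ inj₁ ∘ extend Mu , inj₂ ∘ extend Mv ]′ Puv)
    where
    extend : ∀ {w} → Misses M w → Misses P w → Misses ((x , y) ∷ P) w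
    extend {w} Mw Pw = (proj₂ (All.head (f Mw)) , λ { refl → ¬M′y (All.tail (f Mw)) }) ∷ Pw

  MatchingOfSize : List (Fin n) → ℕ → Set
  MatchingOfSize A k = ∃ λ es → Matching es × Avoids (_∈ A) es × length es ≡ k

  -- The search runs over the first edge, whose ends then join the avoided list. It lets
  -- `completion` decide which case of the induction applies.
  matchingOfSize? : ∀ A k → Dec (MatchingOfSize A k)
  matchingOfSize? A zero    = yes ([] , [] , (λ _ → []) , refl)
  matchingOfSize? A (suc k) = map′ to from
    (any? λ u → any? λ v → (adj G u v ≟ᵇ true) ×-dec ¬? (u ∈? A) ×-dec ¬? (v ∈? A)
      ×-dec matchingOfSize? (u ∷ v ∷ A) k)
    where
    to : (∃₂ λ u v → u ∼ v × u ∉ A × v ∉ A × MatchingOfSize (u ∷ v ∷ A) k) → MatchingOfSize A (suc k)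
    to (u , v , u∼v , u∉ , v∉ , es , m , av , l) = (u , v) ∷ es ,
      cons u∼v (av (here refl)) (av (there (here refl))) m ,
      (λ z∈ → ((λ { refl → u∉ z∈ }) , (λ { refl → v∉ z∈ })) ∷ av (there (there z∈))) ,
      cong suc l
    from : MatchingOfSize A (suc k) → ∃₂ λ u v → u ∼ v × u ∉ A × v ∉ A × MatchingOfSize (u ∷ v ∷ A) k
    from ((u , v) ∷ es , cons u∼v mu mv m , av , l) =
      u , v , u∼v , (λ u∈ → proj₁ (All.head (av u∈)) refl) , (λ v∈ → proj₂ (All.head (av v∈)) refl) ,
      es , m ,
      (λ { (here refl) → mu ; (there (here refl)) → mv ; (there (there z∈)) → All.tail (av z∈) }) ,
      suc-injective l

  Matching-++ : ∀ {P Q} → Matching P → Matching Q →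
    All (λ e → Misses Q (proj₁ e) × Misses Q (proj₂ e)) P → Matching (P ++ Q)
  Matching-++ []                  mQ []               = mQ
  Matching-++ (cons u∼v mu mv mP) mQ ((Qu , Qv) ∷ Qs) =
    cons u∼v (All.++⁺ mu Qu) (All.++⁺ mv Qv) (Matching-++ mP mQ Qs)

  Matching-edges : ∀ {P} → Matching P → All (λ e → proj₁ e ∼ proj₂ e) P
  Matching-edges []               = []
  Matching-edges (cons u∼v _ _ m) = u∼v ∷ Matching-edges m

  endpoints : List (Edge n) → List (Fin n)
  endpoints []             = []
  endpoints ((u , v) ∷ es) = u ∷ v ∷ endpoints es

  length-endpoints : ∀ es → length (endpoints es) ≡ length es + length es
  length-endpoints []       = refl
  length-endpoints (_ ∷ es) = cong suc (trans (cong suc (length-endpoints es)) (≡.sym (+-suc _ _)))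

  ¬Misses⇒∈endpoints : ∀ es {x} → ¬ Misses es x → x ∈ endpoints es
  ¬Misses⇒∈endpoints []             ¬m = contradiction [] ¬m
  ¬Misses⇒∈endpoints ((u , v) ∷ es) {x} ¬m with x ≟ u | x ≟ v
  ... | yes x≡u | _       = here x≡u
  ... | no _    | yes x≡v = there (here x≡v)
  ... | no x≢u  | no x≢v  = there (there (¬Misses⇒∈endpoints es (λ m → ¬m ((x≢u , x≢v) ∷ m))))

  incident? : ∀ (hs : List (Fin n)) (e : Edge n) → Dec (proj₁ e ∈ hs)
  incident? hs e = proj₁ e ∈? hs

  -- For hs closed under adjacency outside A, and P avoiding A, these are the edges of P inside hs.
  _↾_ : List (Edge n) → List (Fin n) → List (Edge n)
  P ↾ hs = filter (incident? hs) P

  Matching-↾ : ∀ {P} hs → Matching P → Matching (P ↾ hs)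
  Matching-↾ hs [] = []
  Matching-↾ hs (cons {u} u∼v mu mv m) with u ∈? hs
  ... | yes _ = cons u∼v (All.filter⁺ (incident? hs) mu) (All.filter⁺ (incident? hs) mv) (Matching-↾ hs m)
  ... | no _  = Matching-↾ hs m

  module _ {A : List (Fin n)} where

    -- The filter looks at first endpoints only. If `x` is the second endpoint of an edge of `P`,
    -- the first lies in `hs ++ A` by closedness and not in `A` because `P` avoids `A`, so the edge
    -- is kept.
    Misses-↾⇒Misses : ∀ {P hs x} → Closed {A} hs → Matching P → Avoids (_∈ A) P →
      x ∈ hs → Misses (P ↾ hs) x → Misses P x
    Misses-↾⇒Misses {P} {hs} {x} closed m av x∈ miss = All.tabulate λ {e} e∈ →
      (λ { refl → proj₁ (All.lookup miss (∈-filter⁺ (incident? hs) e∈ x∈)) refl }) ,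
      (λ { refl → [ (λ u∈hs → proj₂ (All.lookup miss (∈-filter⁺ (incident? hs) e∈ u∈hs)) refl)
                  , (λ u∈A → proj₁ (All.lookup (av u∈A) e∈) refl) ]′
                  (∈-++⁻ hs (closed x∈ (∼-sym (All.lookup (Matching-edges m) e∈)))) })

    -- Edges of `P` that start in `hs` end in `hs ++ A`, which `Q` avoids. A bound for the union
    -- thus limits `Q` to what the component leaves over.
    matching-of-component-and-rest : ∀ {P Q hs} → Closed {A} hs →
      Matching P → Avoids (_∈ A) P → Matching Q → Avoids (_∈ hs ++ A) Q →
      Matching (P ↾ hs ++ Q) × Avoids (_∈ A) (P ↾ hs ++ Q)
    matching-of-component-and-rest {P} {Q} {hs} closed mP aP mQ aQ =
      Matching-++ mP↾ mQ (All.zipWith (λ (u∈ , u∼v) → aQ (∈-++⁺ˡ u∈) , aQ (closed u∈ u∼v))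
        (All.all-filter (incident? hs) P , Matching-edges mP↾)) ,
      (λ z∈ → All.++⁺ (All.filter⁺ (incident? hs) (aP z∈)) (aQ (∈-++⁺ʳ hs z∈)))
      where
      mP↾ : Matching (P ↾ hs)
      mP↾ = Matching-↾ hs mP

  -- Gallai's lemma

  module _ {A : List (Fin n)} {k : ℕ}
           (bound : ∀ {P} → Matching P → Avoids (_∈ A) P → length P ≤ k) where

    Linked : Fin n → Fin n → Set
    Linked u v = ∀ {P} → Matching P → Avoids (_∈ A) P → length P ≡ k → Misses P u → Misses P v → u ≡ v

    adjacent⇒Linked : ∀ {u v} → u ∉ A → v ∉ A → u ∼ v → Linked u v
    adjacent⇒Linked u∉ v∉ u∼v m a l Pu Pv = contradiction
      (bound (cons u∼v Pu Pv m) (λ z∈ → ((λ { refl → u∉ z∈ }) , (λ { refl → v∉ z∈ })) ∷ a z∈))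
      (<⇒≱ (≤-reflexive (cong suc (≡.sym l))))

    module _ (missable : ∀ t → t ∉ A → MatchingOfSize (t ∷ A) k) where

      -- Suppose `P` misses distinct `u` and `v`, and let `N` be a maximum matching missing `t`. By
      -- `exchange` some maximum matching misses `t` and one of `u`, `v`. Then `t` equals that
      -- vertex, and the other link applies to `P`.
      Linked-trans : ∀ {u t v} → t ∉ A → Linked u t → Linked t v → Linked u v
      Linked-trans {u} {t} {v} t∉ ut tv {P} m a l Pu Pv with u ≟ v | missable t t∉
      ... | yes u≡v | _ = u≡v
      ... | no u≢v  | N , mN , aN , lN
        with exchange k {X = _∈ A} m mN l lN a (aN ∘ there) (aN (here refl)) Pu Pv u≢v
      ...   | inj₁ (Q , mQ , aQ , lQ) =
              contradiction (bound mQ aQ) (<⇒≱ (≤-reflexive (≡.sym lQ)))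
      ...   | inj₂ (Q , mQ , aQ , lQ , Qt , inj₁ Qu) with refl ← ut mQ aQ lQ Qu Qt = tv m a l Pu Pv
      ...   | inj₂ (Q , mQ , aQ , lQ , Qt , inj₂ Qv) with refl ← tv mQ aQ lQ Qt Qv = ut m a l Pu Pv

      Tree⇒Linked : ∀ {hs} → Tree {A} hs → ∀ {x y} → x ∈ hs → y ∈ hs → Linked x y
      Tree⇒Linked t                (here refl) (here refl) _ _ _ _ _ = refl
      Tree⇒Linked (grow {hs = hs} y∉ x∈ y∼x t) (here refl) (there z∈) =
        Linked-trans (Tree-fresh t x∈) (adjacent⇒Linked (y∉ ∘ ∈-++⁺ʳ hs) (Tree-fresh t x∈) y∼x)
          (Tree⇒Linked t x∈ z∈)
      Tree⇒Linked (grow {hs = hs} y∉ x∈ y∼x t) (there z∈) (here refl) =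
        Linked-trans (Tree-fresh t x∈) (Tree⇒Linked t z∈ x∈)
          (adjacent⇒Linked (Tree-fresh t x∈) (y∉ ∘ ∈-++⁺ʳ hs) (∼-sym y∼x))
      Tree⇒Linked (grow _ _ _ t)   (there z∈)  (there w∈)  = Tree⇒Linked t z∈ w∈

      -- All vertices of `hs` are linked, so `P` misses at most one of them; the `suc` accounts for
      -- it.
      length-component≤ : ∀ {hs P} → Unique hs → Tree {A} hs → Closed {A} hs →
        Matching P → Avoids (_∈ A) P → length P ≡ k →
        length hs ≤ suc (length (P ↾ hs) + length (P ↾ hs))
      length-component≤ {hs} {P} uniq t closed m a l with Any.any? (misses? P) hs
      ... | no none = m≤n⇒m≤1+n (≤-trans (Unique-⊆⇒length≤ uniq covered)
                        (≤-reflexive (length-endpoints (P ↾ hs))))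
        where
        covered : hs ⊆ endpoints (P ↾ hs)
        covered x∈ = ¬Misses⇒∈endpoints (P ↾ hs)
          (λ miss → All.lookup (All.¬Any⇒All¬ hs none) x∈ (Misses-↾⇒Misses closed m a x∈ miss))
      ... | yes some with find some
      ...   | z , z∈ , Pz = ≤-trans (Unique-⊆⇒length≤ uniq covered)
                              (s≤s (≤-reflexive (length-endpoints (P ↾ hs))))
        where
        covered : hs ⊆ z ∷ endpoints (P ↾ hs)
        covered {x} x∈ with misses? (P ↾ hs) x
        ... | no ¬miss = there (¬Misses⇒∈endpoints (P ↾ hs) ¬miss)
        ... | yes miss = here (Tree⇒Linked t x∈ z∈ m a l (Misses-↾⇒Misses closed m a x∈ miss) Pz)

  crossing-edge : ∀ {A v a} → v ∉ A → a ∈ A → Reachable G v a → ∃₂ λ r b → r ∉ A × b ∈ A × r ∼ b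
  crossing-edge v∉ a∈ here = contradiction a∈ v∉
  crossing-edge {A} {v} v∉ a∈ (step {w = w} v∼w reach) with w ∈? A
  ... | yes w∈ = v , w , v∉ , w∈ , v∼w
  ... | no w∉  = crossing-edge w∉ a∈ reach

  smaller-half : ∀ p {a b} → a + b ≤ suc (p + p) → a ≤ p ⊎ b ≤ p
  smaller-half p {a} {b} a+b≤ with a ≤? p
  ... | yes a≤p = inj₁ a≤p
  ... | no a≰p  = inj₂ (+-cancelˡ-≤ (suc p) b p (≤-trans (+-monoˡ-≤ b (≰⇒> a≰p)) a+b≤))

  -- Completing a set that meets every component

  Completion : List (Fin n) → ℕ → Set
  Completion A k = ∃ λ xs → length xs ≤ k × Spreads xs A (allFin n)

  -- Induction on `d`, which bounds the number of vertices outside `A`; every recursive call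
  -- enlarges `A`. The number `k` is any upper bound for the matching number of `G - A`.
  completion : ∀ d {k A} → Unique A → n ≤ length A + d →
    (∀ v → ∃ λ a → a ∈ A × Reachable G v a) →
    (∀ {P} → Matching P → Avoids (_∈ A) P → length P ≤ k) → Completion A k
  completion d {k} {A} uniq n≤ reach bound with any? (λ v → ¬? (v ∈? A))
  ... | no none = [] , z≤n , λ act _ {u} _ → act (decidable-stable (u ∈? A) (λ u∉ → none (u , u∉)))
  completion zero {A = A} uniq n≤ _ _ | yes (v , v∉) =
    contradiction (≤-trans n≤ (≤-reflexive (+-identityʳ _)))
      (<⇒≱ (Unique⇒length≤n (All.¬Any⇒All¬ A v∉ ∷ uniq)))
  completion (suc d) {k} {A} uniq n≤ reach bound | yes (v , v∉)
    -- If `k` is not attained by any matching outside `A`, every `t` outside `A` qualifies.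
    with any? (λ t → ¬? (t ∈? A) ×-dec ¬? (matchingOfSize? (t ∷ A) k))
  completion (suc d) {zero} _ _ _ _ | yes _ | yes (t , _ , none) =
    ⊥-elim (none ([] , [] , (λ _ → []) , refl))
  completion (suc d) {suc k} {A} uniq n≤ reach bound | yes _ | yes (t , t∉ , none)
    -- No matching of size `suc k` avoids `t ∷ A`, so the bound drops by one, which pays for the
    -- seed `t`.
    with completion d {k} {t ∷ A} (All.¬Any⇒All¬ A t∉ ∷ uniq) (≤-trans n≤ (≤-reflexive (+-suc _ d)))
           (λ v → let a , a∈ , r = reach v in a , there a∈ , r)
           (λ {P} m a → ≤-pred (≤∧≢⇒< (bound m (a ∘ there)) (λ l → none (P , m , a , l))))
  ... | xs , l , spreads = t ∷ xs , s≤s l , λ act seed →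
    spreads (λ { (here refl) → 0 , seed (here refl) ; (there u∈) → act u∈ }) (seed ∘ there)
  completion (suc d) {k} {A} uniq n≤ reach bound | yes (v , v∉) | no none
    with reach v
  ... | a , a∈ , r with crossing-edge v∉ a∈ r
  ... | r₀ , b , r₀∉ , b∈ , r₀∼b
    with grow-to-Closed uniq (suc d) (root r₀∉ b∈ r₀∼b) (m≤n⇒m≤1+n n≤)
       | decidable-stable (matchingOfSize? (v ∷ A) k) (λ ¬m → none (v , v∉ , ¬m))
  ... | hs , tree , closed | P , mP , aP , lP
    -- The edges of `P` inside `hs` pay for the seeds of `hs`; the rest of the budget goes to the
    -- vertices outside `hs ++ A`.
    with completion d {k ∸ length (P ↾ hs)} {hs ++ A} (Tree-Unique uniq tree) n≤′
           (λ v → let a , a∈ , r = reach v in a , ∈-++⁺ʳ hs a∈ , r) bound′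
    where
    n≤′ : n ≤ length (hs ++ A) + d
    n≤′ = begin
      n                                ≤⟨ n≤ ⟩
      length A + suc d                 ≡⟨ +-suc (length A) d ⟩
      1 + length A + d                 ≤⟨ +-monoˡ-≤ d (+-monoˡ-≤ (length A) (Tree-nonempty tree)) ⟩
      length hs + length A + d         ≡⟨ cong (_+ d) (length-++ hs) ⟨
      length (hs ++ A) + d             ∎
      where open ≤-Reasoning

    bound′ : ∀ {Q} → Matching Q → Avoids (_∈ hs ++ A) Q → length Q ≤ k ∸ length (P ↾ hs)
    bound′ {Q} mQ aQ = m+n≤o⇒m≤o∸n (length Q) (≤-trans
      (≤-reflexive (trans (+-comm (length Q) _) (≡.sym (length-++ (P ↾ hs))))) (bound mPQ aPQ))
      where
      both = matching-of-component-and-rest closed mP (aP ∘ there) mQ aQ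
      mPQ = proj₁ both
      aPQ : Avoids (_∈ A) (P ↾ hs ++ Q)
      aPQ = proj₂ both
  ... | ys , l , spreads = combine (smaller-half (length (P ↾ hs)) (≤-trans length≤
          (length-component≤ bound missable (Unique-++⁻ˡ hs (Tree-Unique uniq tree))
            tree closed mP (aP ∘ there) lP)))
    where
    missable : ∀ t → t ∉ A → MatchingOfSize (t ∷ A) k
    missable t t∉ = decidable-stable (matchingOfSize? (t ∷ A) k) (λ ¬m → none (t , t∉ , ¬m))

    open Split (Tree-Peelable tree [] [] (Tree-fresh tree) (Tree-fresh tree) (λ x∈ x∼y → inj₂ (closed x∈ x∼y)))

    p≤k : length (P ↾ hs) ≤ k
    p≤k = ≤-trans (length-filter (incident? hs) P) (≤-reflexive lP)

    seed-component : ∀ {xs} → length xs ≤ length (P ↾ hs) → Spreads xs A hs → Completion A k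
    seed-component {xs} xs≤ xs-spreads = xs ++ ys ,
      ≤-trans (≤-reflexive (length-++ xs)) (≤-trans (+-mono-≤ xs≤ l) (≤-reflexive (m+[n∸m]≡n p≤k))) ,
      λ act seed → spreads
        ([ xs-spreads act (seed ∘ ∈-++⁺ˡ) , act ]′ ∘ ∈-++⁻ hs) (seed ∘ ∈-++⁺ʳ xs)

    combine : length front ≤ length (P ↾ hs) ⊎ length back ≤ length (P ↾ hs) → Completion A k
    combine (inj₁ f≤) = seed-component f≤ front-spreads
    combine (inj₂ b≤) = seed-component b≤ back-spreads

-- Seeding one representative per component.

theorem4 : ∀ {n} (G : Graph n) (m c : ℕ) → IsMatchingNumber G m → IsComponentCount G c →
    Σ (Subset n) λ M → IsDynamo G M × ∣ M ∣ ≤ m + c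
theorem4 {n} G m c (_ , max) (f , surj , f-components)
  -- Initially `A` consists of the `c` representatives. At most `n` vertices lie outside it, and
  -- every matching avoiding it is a matching of `G`, hence the bounds `n` and `m`.
  with completion G n {m} {tabulate (proj₁ ∘ surj)}
         (tabulate⁺ (λ {i} {j} eq → trans (≡.sym (proj₂ (surj i))) (trans (cong f eq) (proj₂ (surj j)))))
         (m≤n+m n _)
         (λ v → proj₁ (surj (f v)) , ∈-tabulate⁺ (f v) , proj₁ (f-components v _) (≡.sym (proj₂ (surj (f v)))))
         (λ mP _ → max _ (Matching⇒IsMatching G mP))
... | xs , xs≤m , spreads =
  fromList (xs ++ reps) ,
  Activated⇒IsDynamo G (λ u → spreads (λ a∈ → 0 , ∈⇒lookup-fromList (∈-++⁺ʳ xs a∈))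
    (∈⇒lookup-fromList ∘ ∈-++⁺ˡ) (∈-allFin u)) ,
  (begin
    ∣ fromList (xs ++ reps) ∣  ≤⟨ ∣fromList∣≤length (xs ++ reps) ⟩
    length (xs ++ reps)        ≡⟨ length-++ xs ⟩
    length xs + length reps    ≤⟨ +-mono-≤ xs≤m (≤-reflexive (length-tabulate (proj₁ ∘ surj))) ⟩
    m + c                      ∎)
  where
  open ≤-Reasoning
  reps : List (Fin n)
  reps = tabulate (proj₁ ∘ surj)
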